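{- For every integer $n\ge 0$ there is a bijection $\varphi_n:\mathcal{DP}(n)\to\mathcal{MP}^*(n)$ from the set of area sequences of size $n$ to the set of bicolored Motzkin sequences of size $n$ with the following properties. If $\varphi_n(\mathbf a)=\mathbf w^*_{\mathbf a}$, and $\mathbf w_{\mathbf a}$ denotes the uncolored version of $\mathbf w^*_{\mathbf a}$, then (i) the peak-nesting vector of $\mathbf a$ is $\mathbf{pnv}(\mathbf a)=\mathbf w_{\mathbf a}$; (ii) $\mathrm{peak}(\mathbf a)=1+\mathrm{asc}(\mathbf w^*_{\mathbf a})+\mathrm{decor}(\mathbf w^*_{\mathbf a})$.
   Context: Write $[n]=\{1,\dots,n\}$. An area sequence of size $n$ is a sequence $\mathbf a=(a_1,\dots,a_n)$ of nonnegative integers with $a_i<i$ for all $i$ and $a_i\le a_{i-1}+1$ for all $i\ge 2$; $\mathcal{DP}(n)$ is the set of all of them (for $n=0$, only the empty sequence). Each $\mathbf a\in\mathcal{DP}(n)$ defines a graph $\Gamma_{\mathbf a}$ (a unit interval graph) on vertex set $[n]$ with edges $\{j,i\}$ for $1\le j<i\le n$ with $i-a_i\le j$. If $\{i,j\}$ with $i<j$ is an edge then $\{i,i+1,\dots,j\}$ is a clique. A peak-edge of $\Gamma_{\mathbf a}$ is either an isolated vertex $i$ (in which case put $j=i$) or an edge $\{i,j\}$, $i<j$, such that neither $\{i,j+1\}$ nor $\{i-1,j\}$ is an edge (pairs not contained in $[n]$ are not edges). The corresponding peak-clique is $\{i,i+1,\dots,j\}$. The number of peak-edges is $\mathrm{peak}(\mathbf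 a)$. The peak-nesting $\mathrm{pnest}(i)$ of a vertex $i$ is the number of peak-cliques containing $i$, and $\mathbf{pnv}(\mathbf a)=(\mathrm{pnest}(1),\dots,\mathrm{pnest}(n))$. A Motzkin sequence of size $n$ is a sequence $(w_1,\dots,w_n)$ of positive integers with $w_1=w_n=1$ and $|w_i-w_{i+1}|\le 1$ for $1\le i<n$ (for $n=0$, the empty sequence). An index $i\in[n-1]$ is an ascent if $w_i<w_{i+1}$ and a plateau if $w_i=w_{i+1}$. A bicolored Motzkin sequence is a Motzkin sequence in which each plateau is either marked with $*$ or not; $\mathcal{MP}^*(n)$ is the set of those of size $n$. The uncolored version is obtained by forgetting the marks. $\mathrm{asc}$ denotes the number of ascents (marks do not affect it) and $\mathrm{decor}$ the number of marked plateaus.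
   Formalization: Part (ii) is stated only for n ≥ 1, since for n = 0 the empty sequence has no peak-edges, so peak = 0 while 1 + asc + decor = 1; the bijection and (i) are stated for all n ≥ 0. -}

module Defs where

open import Data.Fin using (Fin; toℕ)
open import Data.Fin.Properties using (any?; all?)
  renaming (_≟_ to _≟ᶠ_)
open import Data.Fin.Subset using (Subset; ∣_∣; _∈_)
open import Data.List using (List; length; filter; allFin; cartesianProduct)
open import Data.Nat using (ℕ; suc; _+_; _∸_; _≤_; _<_; ∣_-_∣)
open import Data.Nat.Properties using (_≟_; _≤?_; _<?_)
open import Data.Product using (_×_; _,_; ∃-syntax; proj₁; proj₂)
open import Data.Refinement using (Refinement-syntax; value)
open import Data.Sum using (_⊎_)
open import Data.Vec using (Vec; lookup; tabulate)
open import Relation.Binary.PropositionalEquality using (_≡_)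
open import Relation.Nullary using (¬_; Dec; ¬?; _×-dec_; _⊎-dec_; _→-dec_)

private
  variable
    n : ℕ

-- The element of [n] = {1,…,n} that an index stands for.
label : Fin n → ℕ
label i = suc (toℕ i)

-- i ⋖ j : j is the index immediately after i.
_⋖_ : Fin n → Fin n → Set
i ⋖ j = label j ≡ suc (label i)

_⋖?_ : (i j : Fin n) → Dec (i ⋖ j)
i ⋖? j = label j ≟ suc (label i)

record IsArea (a : Vec ℕ n) : Set where
  field
    bound : ∀ i → lookup a i < label i
    step  : ∀ i j → i ⋖ j → lookup a j ≤ lookup a i + 1

-- Validity proofs are irrelevant (here and in the refinements below), so
-- propositional equality of these objects is equality of the underlying data.
DP : ℕ → Set
DP n = [ a ∈ Vec ℕ n ∣ IsArea a ]

-- Edge a j i : {j , i} is an edge, with j the smaller endpoint.  Truncated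
-- subtraction is harmless, as aᵢ < i for area sequences.
Edge : Vec ℕ n → Fin n → Fin n → Set
Edge a j i = label j < label i × label i ∸ lookup a i ≤ label j

edge? : (a : Vec ℕ n) (j i : Fin n) → Dec (Edge a j i)
edge? a j i = (label j <? label i) ×-dec (label i ∸ lookup a i ≤? label j)

Isolated : Vec ℕ n → Fin n → Set
Isolated a i = ∀ k → ¬ (Edge a i k ⊎ Edge a k i)

isolated? : (a : Vec ℕ n) (i : Fin n) → Dec (Isolated a i)
isolated? a i = all? λ k → ¬? (edge? a i k ⊎-dec edge? a k i)

-- An isolated vertex i is represented by the pair (i , i).  Quantifying over
-- k with j ⋖ k (resp. k ⋖ i) makes the condition on j + 1 (resp. i - 1)
-- vacuous when that number lies outside [n].
PeakEdge : Vec ℕ n → Fin n × Fin n → Set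
PeakEdge a (i , j) =
  (i ≡ j × Isolated a i) ⊎
  (Edge a i j × (∀ k → j ⋖ k → ¬ Edge a i k) × (∀ k → k ⋖ i → ¬ Edge a k j))

peakEdge? : (a : Vec ℕ n) (e : Fin n × Fin n) → Dec (PeakEdge a e)
peakEdge? a (i , j) =
  ((i ≟ᶠ j) ×-dec isolated? a i) ⊎-dec
  (edge? a i j
    ×-dec (all? λ k → (j ⋖? k) →-dec ¬? (edge? a i k))
    ×-dec (all? λ k → (k ⋖? i) →-dec ¬? (edge? a k j)))

peakEdges : Vec ℕ n → List (Fin n × Fin n)
peakEdges {n} a = filter (peakEdge? a) (cartesianProduct (allFin n) (allFin n))

peak : DP n → ℕ
peak a = length (peakEdges (value a))

-- v belongs to the clique {i, i+1, …, j}.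
InClique : Fin n → Fin n × Fin n → Set
InClique v (i , j) = label i ≤ label v × label v ≤ label j

inClique? : (v : Fin n) (e : Fin n × Fin n) → Dec (InClique v e)
inClique? v (i , j) = (label i ≤? label v) ×-dec (label v ≤? label j)

-- Distinct peak-edges have distinct peak-cliques, since a nonempty interval
-- determines its endpoints; so counting peak-edges counts peak-cliques.
pnest : DP n → Fin n → ℕ
pnest a v = length (filter (inClique? v) (peakEdges (value a)))

pnv : DP n → Vec ℕ n
pnv a = tabulate (pnest a)

record IsMotzkin (w : Vec ℕ n) : Set where
  field
    positive : ∀ i → 0 < lookup w i
    first    : ∀ i → label i ≡ 1 → lookup w i ≡ 1
    last     : ∀ i → label i ≡ n → lookup w i ≡ 1
    step     : ∀ i j → i ⋖ j → ∣ lookup w i - lookup w j ∣ ≤ 1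

Motzkin : ℕ → Set
Motzkin n = [ w ∈ Vec ℕ n ∣ IsMotzkin w ]

-- Requiring a successor j in [n] restricts i to [n-1].
Ascent : Vec ℕ n → Fin n → Set
Ascent w i = ∃[ j ] (i ⋖ j × lookup w i < lookup w j)

ascent? : (w : Vec ℕ n) (i : Fin n) → Dec (Ascent w i)
ascent? w i = any? λ j → (i ⋖? j) ×-dec (lookup w i <? lookup w j)

Plateau : Vec ℕ n → Fin n → Set
Plateau w i = ∃[ j ] (i ⋖ j × lookup w i ≡ lookup w j)

-- A Motzkin sequence together with the set of its indices marked with *.
MP* : ℕ → Set
MP* n =
  [ p ∈ Motzkin n × Subset n ∣ (∀ i → i ∈ proj₂ p → Plateau (value (proj₁ p)) i) ]

uncolored : MP* n → Motzkin n
uncolored w* = proj₁ (value w*)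

marks : MP* n → Subset n
marks w* = proj₂ (value w*)

asc : MP* n → ℕ
asc {n} w* = length (filter (ascent? (value (uncolored w*))) (allFin n))

decor : MP* n → ℕ
decor w* = ∣ marks w* ∣

{-# OPTIONS --safe #-}

-- Number the vertices from 0, extend a by zeros, and let c j = j − aⱼ, a weakly
-- increasing function with c n = n.  The peak-cliques are the intervals
-- [c t , t] with c t < c (t + 1); both their left ends and their right ends are
-- pairwise distinct.  Let r j be the number of right ends before j and ℓ v the
-- number of left ends up to v.  Then pnest v = ℓ v − r v, so the nesting vector
-- changes by +1, −1 or 0 as v + 1 is a left end, v is a right end, or both or
-- neither hold, and the marks tell the last two cases apart: they recover r and
-- ℓ from the bicolored path.  The area sequence is recovered through the
-- Galois connection  c j ≤ v ⇔ r j < ℓ v,  which in turn determines r and ℓ.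
-- Finally peak = ℓ (n − 1) counts the left end 0, one left end per ascent and
-- one per mark.

module Submission where

open import Defs
open import Data.Bool using (Bool; true; false; if_then_else_)
open import Data.Bool.Properties using () renaming (_≟_ to _≟ᵇ_)
open import Data.Fin using (Fin; toℕ; fromℕ<; inject₁) renaming (zero to fzero; suc to fsuc)
open import Data.Fin.Properties using (toℕ<n; toℕ-fromℕ<; toℕ-injective; toℕ-inject₁)
open import Data.Fin.Subset using (Subset; ∣_∣) renaming (_∈_ to _∈ˢ_)
open import Data.Fin.Subset.Properties using (drop-there)
open import Data.Irrelevant using ([_])
open import Data.List using (List; length; filter; allFin; map; cartesianProduct) renaming (tabulate to tabulateˡ)
open import Data.List.Membership.Propositional using (_∈_)
open import Data.List.Membership.Propositional.Properties
  using (∈-filter⁺; ∈-filter⁻; ∈-map∘filter⁺; ∈-map∘filter⁻; ∈-allFin; ∈-cartesianProduct⁺)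
open import Data.List.Membership.Propositional.Properties.WithK using (unique∧set⇒bag)
open import Data.List.Properties using (length-map)
open import Data.List.Relation.Binary.BagAndSetEquality using (∼bag⇒↭)
open import Data.List.Relation.Binary.Permutation.Propositional.Properties using (↭-length)
open import Data.List.Relation.Unary.Unique.Propositional using (Unique)
import Data.List.Relation.Unary.Unique.Propositional.Properties as Unique
open import Data.Nat using (ℕ; zero; suc; _+_; _∸_; _≤_; _<_; z≤n; s≤s; z<s; s<s; s≤s⁻¹; ∣_-_∣)
open import Data.Nat.Properties
open import Data.Product using (Σ-syntax; ∃-syntax; _×_; _,_; proj₁; proj₂)
open import Data.Refinement using (value; value-injective; _,_)
open import Data.Sum using (_⊎_; inj₁; inj₂)
open import Data.Vec using (Vec; []; _∷_; here; there; lookup; tabulate)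
open import Data.Vec.Properties using (lookup∘tabulate; []=⇒lookup; lookup⇒[]=; ≡-dec)
open import Function using (_∘_; id)
open import Function.Consequences.Propositional using (strictlySurjective⇒surjective)
open import Function.Bundles using (_⤖_; module Bijection; mk⤖; _⇔_; mk⇔; Equivalence)
open import Relation.Binary using (tri<; tri≈; tri>)
open import Relation.Binary.PropositionalEquality using (_≡_; refl; sym; trans; cong; cong₂; subst; subst₂; module ≡-Reasoning)
open import Relation.Nullary using (¬_; Dec; yes; no; contradiction; does; recompute; _×-dec_; _⊎-dec_)
open import Relation.Nullary.Decidable using (dec-true)
open import Relation.Unary using (Pred; Decidable)
open import Level using (0ℓ)

private
  variable
    n : ℕ
    P Q R : Pred ℕ 0ℓ

-- Indicators of decidable propositions.

⟦_⟧ : {A : Set} → Dec A → ℕ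
⟦ d ⟧ = if does d then 1 else 0

module _ {A : Set} where

  ⟦⟧-yes : (d : Dec A) → A → ⟦ d ⟧ ≡ 1
  ⟦⟧-yes (yes _) _ = refl
  ⟦⟧-yes (no ¬a) a = contradiction a ¬a

  ⟦⟧-no : (d : Dec A) → ¬ A → ⟦ d ⟧ ≡ 0
  ⟦⟧-no (yes a) ¬a = contradiction a ¬a
  ⟦⟧-no (no _)  _  = refl

  ⟦⟧≤1 : (d : Dec A) → ⟦ d ⟧ ≤ 1
  ⟦⟧≤1 (yes _) = ≤-refl
  ⟦⟧≤1 (no _)  = z≤n

  does-true⁻ : (d : Dec A) → does d ≡ true → A
  does-true⁻ (yes a) _ = a

⟦⟧-mono : {A B : Set} (d : Dec A) (e : Dec B) → (A → B) → ⟦ d ⟧ ≤ ⟦ e ⟧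
⟦⟧-mono (yes a) e f = ≤-reflexive (sym (⟦⟧-yes e (f a)))
⟦⟧-mono (no _)  e f = z≤n

⟦⟧-cong : {A B : Set} (d : Dec A) (e : Dec B) → (A → B) → (B → A) → ⟦ d ⟧ ≡ ⟦ e ⟧
⟦⟧-cong d e f g = ≤-antisym (⟦⟧-mono d e f) (⟦⟧-mono e d g)

-- Counting below a bound

count : Decidable P → ℕ → ℕ
count P? zero    = 0
count P? (suc n) = ⟦ P? n ⟧ + count P? n

count-⊆ : (P? : Decidable P) (Q? : Decidable Q) → ∀ n →
          (∀ i → i < n → P i → Q i) → count P? n ≤ count Q? n
count-⊆ P? Q? zero    P⊆Q = z≤n
count-⊆ P? Q? (suc n) P⊆Q =
  +-mono-≤ (⟦⟧-mono (P? n) (Q? n) (P⊆Q n ≤-refl))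
           (count-⊆ P? Q? n λ i i<n → P⊆Q i (m≤n⇒m≤1+n i<n))

count-≐ : (P? : Decidable P) (Q? : Decidable Q) → ∀ n →
          (∀ i → i < n → P i → Q i) → (∀ i → i < n → Q i → P i) →
          count P? n ≡ count Q? n
count-≐ P? Q? n P⊆Q Q⊆P = ≤-antisym (count-⊆ P? Q? n P⊆Q) (count-⊆ Q? P? n Q⊆P)

count-⊂ : (P? : Decidable P) (Q? : Decidable Q) → ∀ n →
          (∀ i → i < n → P i → Q i) →
          ∀ {k} → k < n → ¬ P k → Q k → count P? n < count Q? n
count-⊂ P? Q? (suc n) P⊆Q {k} k<1+n ¬Pk Qk with m≤n⇒m<n∨m≡n (s≤s⁻¹ k<1+n)
... | inj₁ k<n = +-mono-≤-< (⟦⟧-mono (P? n) (Q? n) (P⊆Q n ≤-refl))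
                   (count-⊂ P? Q? n (λ i i<n → P⊆Q i (m≤n⇒m≤1+n i<n)) k<n ¬Pk Qk)
... | inj₂ refl rewrite ⟦⟧-no (P? n) ¬Pk | ⟦⟧-yes (Q? n) Qk =
  s≤s (count-⊆ P? Q? n λ i i<n → P⊆Q i (m≤n⇒m≤1+n i<n))

count-∅ : (P? : Decidable P) → ∀ n → (∀ i → i < n → ¬ P i) → count P? n ≡ 0
count-∅ P? zero    ¬P = refl
count-∅ P? (suc n) ¬P =
  cong₂ _+_ (⟦⟧-no (P? n) (¬P n ≤-refl)) (count-∅ P? n λ i i<n → ¬P i (m≤n⇒m≤1+n i<n))

count-mono : (P? : Decidable P) → ∀ {i j} → i ≤ j → count P? i ≤ count P? j
count-mono P? {j = zero}  z≤n = ≤-refl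
count-mono P? {i} {suc j} i≤1+j with m≤n⇒m<n∨m≡n i≤1+j
... | inj₁ i<1+j = ≤-trans (count-mono P? (s≤s⁻¹ i<1+j)) (m≤n+m _ ⟦ P? j ⟧)
... | inj₂ refl  = ≤-refl

count≤ : (P? : Decidable P) → ∀ n → count P? n ≤ n
count≤ P? zero    = z≤n
count≤ P? (suc n) = +-mono-≤ (⟦⟧≤1 (P? n)) (count≤ P? n)

count-⊎ : (P? : Decidable P) (Q? : Decidable Q) (R? : Decidable R) → ∀ n →
          (∀ i → i < n → P i → ¬ Q i) →
          (∀ i → i < n → R i → P i ⊎ Q i) →
          (∀ i → i < n → P i ⊎ Q i → R i) →
          count R? n ≡ count P? n + count Q? n
count-⊎ P? Q? R? zero    dis R⊆ ⊆R = refl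
count-⊎ P? Q? R? (suc n) dis R⊆ ⊆R
  with P? n | Q? n | R? n
     | count-⊎ P? Q? R? n (λ i i<n → dis i (m≤n⇒m≤1+n i<n))
                          (λ i i<n → R⊆ i (m≤n⇒m≤1+n i<n)) (λ i i<n → ⊆R i (m≤n⇒m≤1+n i<n))
... | yes p | yes q | _      | _  = contradiction q (dis n ≤-refl p)
... | yes p | no _  | yes _  | ih = cong suc ih
... | yes p | no _  | no ¬r  | _  = contradiction (⊆R n ≤-refl (inj₁ p)) ¬r
... | no _  | yes q | yes _  | ih = trans (cong suc ih) (sym (+-suc _ _))
... | no _  | yes q | no ¬r  | _  = contradiction (⊆R n ≤-refl (inj₂ q)) ¬r
... | no _  | no _  | no _   | ih = ih
... | no ¬p | no ¬q | yes r  | _ with R⊆ n ≤-refl r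
...   | inj₁ p = contradiction p ¬p
...   | inj₂ q = contradiction q ¬q

count-subsingleton : (P? : Decidable P) → ∀ n →
                     (∀ i j → i < j → P i → ¬ P j) → count P? n ≤ 1
count-subsingleton P? zero    uniq = z≤n
count-subsingleton P? (suc n) uniq with P? n
... | yes p rewrite count-∅ P? n (λ i i<n q → uniq i n i<n q p) = ≤-refl
... | no _  = count-subsingleton P? n uniq

count-truncate : (P? : Decidable P) → ∀ {v} n → v ≤ n → (∀ i → v ≤ i → ¬ P i) →
                 count P? n ≡ count P? v
count-truncate P? zero z≤n ¬P = refl
count-truncate P? {v} (suc n) v≤1+n ¬P with m≤n⇒m<n∨m≡n v≤1+n
... | inj₂ refl = refl
... | inj₁ v<1+n rewrite ⟦⟧-no (P? n) (¬P n (s≤s⁻¹ v<1+n)) =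
  count-truncate P? n (s≤s⁻¹ v<1+n) ¬P

-- `count` recurses from the top, while lists tabulated over `Fin` and subsets recurse from index 0.
-- Peeling off the bottom index lets inductions on them go through.
count-suc : (P? : Decidable P) → ∀ n →
            count P? (suc n) ≡ ⟦ P? 0 ⟧ + count (P? ∘ suc) n
count-suc P? zero    = refl
count-suc P? (suc n) = begin
  ⟦ P? (suc n) ⟧ + count P? (suc n)                    ≡⟨ cong (⟦ P? (suc n) ⟧ +_) (count-suc P? n) ⟩
  ⟦ P? (suc n) ⟧ + (⟦ P? 0 ⟧ + count (P? ∘ suc) n)     ≡⟨ +-assoc ⟦ P? (suc n) ⟧ ⟦ P? 0 ⟧ _ ⟨
  ⟦ P? (suc n) ⟧ + ⟦ P? 0 ⟧ + count (P? ∘ suc) n       ≡⟨ cong (_+ count (P? ∘ suc) n) (+-comm ⟦ P? (suc n) ⟧ ⟦ P? 0 ⟧) ⟩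
  ⟦ P? 0 ⟧ + ⟦ P? (suc n) ⟧ + count (P? ∘ suc) n       ≡⟨ +-assoc ⟦ P? 0 ⟧ ⟦ P? (suc n) ⟧ _ ⟩
  ⟦ P? 0 ⟧ + count (P? ∘ suc) (suc n)                  ∎
  where open ≡-Reasoning

-- Every value below a count is attained, as counts start at 0 and grow by unit steps.
count-attains : (P? : Decidable P) → ∀ n {x} → x < count P? n → ∃[ j ] (j < n × count P? j ≡ x)
count-attains P? (suc n) {x} x< with <-≤-connex x (count P? n)
... | inj₁ x<c = let j , j<n , eq = count-attains P? n x<c in j , m≤n⇒m≤1+n j<n , eq
... | inj₂ c≤x = n , ≤-refl , ≤-antisym c≤x (s≤s⁻¹ (≤-trans x< (+-monoˡ-≤ _ (⟦⟧≤1 (P? n)))))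

-- For an upward closed predicate, j ∸ count P? j is the least element of P, provided P j.
module _ (P? : Decidable P) (up : ∀ {i j} → i ≤ j → P i → P j) where

  -- By upward closure every index from `v` on is counted, so at most `v` of the indices below `j`
  -- are missed.
  upper-count : ∀ {v} j → P v → j ≤ v + count P? j
  upper-count zero    Pv = z≤n
  upper-count {v} (suc j) Pv with ≤-<-connex v j
  ... | inj₁ v≤j rewrite ⟦⟧-yes (P? j) (up v≤j Pv) | +-suc v (count P? j) =
    s≤s (upper-count j Pv)
  ... | inj₂ j<v = ≤-trans j<v (m≤m+n v _)

  lower-count : ∀ {u} j → u ≤ j → (∀ i → i < u → ¬ P i) → u + count P? j ≤ j
  lower-count zero z≤n ¬P = z≤n
  lower-count {u} (suc j) u≤1+j ¬P with m≤n⇒m<n∨m≡n u≤1+j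
  ... | inj₂ refl rewrite count-∅ P? (suc j) ¬P | +-identityʳ j = ≤-refl
  ... | inj₁ u<1+j = begin
    u + (⟦ P? j ⟧ + count P? j) ≤⟨ +-monoʳ-≤ u (+-monoˡ-≤ _ (⟦⟧≤1 (P? j))) ⟩
    u + suc (count P? j)        ≡⟨ +-suc u _ ⟩
    suc (u + count P? j)        ≤⟨ s≤s (lower-count j (s≤s⁻¹ u<1+j) ¬P) ⟩
    suc j                       ∎
    where open ≤-Reasoning

  threshold⁺ : ∀ {j v} → P v → j ∸ count P? j ≤ v
  threshold⁺ {j} {v} Pv = begin
    j ∸ count P? j                ≤⟨ ∸-monoˡ-≤ (count P? j) (upper-count j Pv) ⟩
    v + count P? j ∸ count P? j   ≡⟨ m+n∸n≡m v (count P? j) ⟩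
    v                             ∎
    where open ≤-Reasoning

  -- If `P v` failed, then `P j` would force `v < j`, and only indices above `v` would be counted.
  -- The least element would then exceed `v`.
  threshold⁻ : ∀ {j v} → P j → j ∸ count P? j ≤ v → P v
  threshold⁻ {j} {v} Pj j∸c≤v with P? v
  ... | yes Pv = Pv
  ... | no ¬Pv = contradiction v<v (n≮n v)
    where
    v<j : v < j
    v<j = ≰⇒> λ j≤v → ¬Pv (up j≤v Pj)

    v<v : v < v
    v<v = begin-strict
      v                                     <⟨ n<1+n v ⟩
      suc v                                 ≡⟨ m+n∸n≡m (suc v) (count P? j) ⟨
      suc v + count P? j ∸ count P? j       ≤⟨ ∸-monoˡ-≤ (count P? j) (lower-count j v<j λ i i<1+v Pi → ¬Pv (up (s≤s⁻¹ i<1+v) Pi)) ⟩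
      j ∸ count P? j                        ≤⟨ j∸c≤v ⟩
      v                                     ∎
      where open ≤-Reasoning

-- Lengths of filtered lists as counts.

length-filter-tabulate : {A : Set} {S : Pred A 0ℓ} (S? : Decidable S) (P? : Decidable P) →
  ∀ {n} (f : Fin n → A) → (∀ i → S (f i) → P (toℕ i)) → (∀ i → P (toℕ i) → S (f i)) →
  length (filter S? (tabulateˡ f)) ≡ count P? n
length-filter-tabulate S? P? {zero}  f to from = refl
length-filter-tabulate S? P? {suc n} f to from
  rewrite count-suc P? n
  with S? (f fzero) | P? 0 | length-filter-tabulate S? (P? ∘ suc) (f ∘ fsuc) (to ∘ fsuc) (from ∘ fsuc)
... | yes _ | yes _ | ih = cong suc ih
... | yes s | no ¬p | _  = contradiction (to fzero s) ¬p
... | no ¬s | yes p | _  = contradiction (from fzero p) ¬s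
... | no _  | no _  | ih = ih

-- Two duplicate-free lists with the same members are permutations of each other, so `xs` is as long
-- as the list of images `g j`. This is how peak-edges get enumerated by their right ends.
length≡count : {A : Set} {xs : List A} → Unique xs → (P? : Decidable P) →
  (g : Fin n → A) → (∀ {i j} → g i ≡ g j → i ≡ j) →
  (∀ {x} → x ∈ xs → ∃[ j ] (P (toℕ j) × x ≡ g j)) →
  (∀ j → P (toℕ j) → g j ∈ xs) →
  length xs ≡ count P? n
length≡count {P} {n} {xs = xs} xs! P? g g-inj ∈⇒ ⇒∈ = begin
  length xs                                       ≡⟨ ↭-length (∼bag⇒↭ (unique∧set⇒bag xs! ys! (mk⇔ xs⊆ys ys⊆xs))) ⟩
  length (map g (filter Pᶠ? (allFin n)))   ≡⟨ length-map g (filter Pᶠ? (allFin n)) ⟩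
  length (filter Pᶠ? (allFin n))           ≡⟨ length-filter-tabulate Pᶠ? P? id (λ _ → id) (λ _ → id) ⟩
  count P? n                                      ∎
  where
  open ≡-Reasoning
  Pᶠ? : Decidable (P ∘ toℕ)
  Pᶠ? i = P? (toℕ i)

  ys! : Unique (map g (filter Pᶠ? (allFin n)))
  ys! = Unique.map⁺ g-inj (Unique.filter⁺ Pᶠ? (Unique.allFin⁺ n))

  xs⊆ys : ∀ {x} → x ∈ xs → x ∈ map g (filter Pᶠ? (allFin n))
  xs⊆ys x∈xs = let j , Pj , x≡gj = ∈⇒ x∈xs in
    ∈-map∘filter⁺ g Pᶠ? (j , ∈-allFin j , x≡gj , Pj)

  ys⊆xs : ∀ {x} → x ∈ map g (filter Pᶠ? (allFin n)) → x ∈ xs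
  ys⊆xs x∈ys with ∈-map∘filter⁻ g Pᶠ? {xs = allFin n} x∈ys
  ... | j , _ , refl , Pj = ⇒∈ j Pj

-- Vectors extended by a default value

at : {A : Set} → A → Vec A n → ℕ → A
at d []       t       = d
at d (x ∷ xs) zero    = x
at d (x ∷ xs) (suc t) = at d xs t

module _ {A : Set} {d : A} where

  at-toℕ : (v : Vec A n) (i : Fin n) → at d v (toℕ i) ≡ lookup v i
  at-toℕ (x ∷ v) fzero    = refl
  at-toℕ (x ∷ v) (fsuc i) = at-toℕ v i

  at-≥ : (v : Vec A n) → ∀ {t} → n ≤ t → at d v t ≡ d
  at-≥ []      _         = refl
  at-≥ (x ∷ v) (s≤s n≤t) = at-≥ v n≤t

  at-tabulate : (f : Fin n → A) (i : Fin n) → at d (tabulate f) (toℕ i) ≡ f i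
  at-tabulate f i = trans (at-toℕ (tabulate f) i) (lookup∘tabulate f i)

  at-ext : (u v : Vec A n) → (∀ t → t < n → at d u t ≡ at d v t) → u ≡ v
  at-ext []      []      eq = refl
  at-ext (x ∷ u) (y ∷ v) eq = cong₂ _∷_ (eq 0 z<s) (at-ext u v λ t t<n → eq (suc t) (s<s t<n))

-- A view: matching on `fin i` turns a number below `n` into `toℕ i`, so that facts about `lookup`
-- apply to `at`.
data Below (n : ℕ) : ℕ → Set where
  fin : (i : Fin n) → Below n (toℕ i)

below : ∀ {t} → t < n → Below n t
below t<n = subst (Below _) (toℕ-fromℕ< t<n) (fin (fromℕ< t<n))

next : (i : Fin n) → suc (toℕ i) < n → ∃[ j ] i ⋖ j
next i 1+i<n = fromℕ< 1+i<n , cong suc (toℕ-fromℕ< 1+i<n)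

prev : (i : Fin n) → 0 < toℕ i → ∃[ k ] k ⋖ i
prev (fsuc i) _ = inject₁ i , cong (suc ∘ suc) (sym (toℕ-inject₁ i))

∣∣≡count : (p : Subset n) (P? : Decidable P) →
  (∀ i → i ∈ˢ p → P (toℕ i)) → (∀ i → P (toℕ i) → i ∈ˢ p) → ∣ p ∣ ≡ count P? n
∣∣≡count [] P? to from = refl
∣∣≡count {n = suc n} (true ∷ p) P? to from
  rewrite count-suc P? n | ⟦⟧-yes (P? 0) (to fzero here) =
  cong suc (∣∣≡count p (P? ∘ suc) (λ i → to (fsuc i) ∘ there) λ i q → drop-there (from (fsuc i) q))
∣∣≡count {n = suc n} (false ∷ p) P? to from
  rewrite count-suc P? n | ⟦⟧-no (P? 0) (λ q → contradiction (from fzero q) λ ()) =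
  ∣∣≡count p (P? ∘ suc) (λ i → to (fsuc i) ∘ there) λ i q → drop-there (from (fsuc i) q)

-- Area sequences as staircases

steps⇒mono : {f : ℕ → ℕ} → (∀ t → f t ≤ f (suc t)) → ∀ {i j} → i ≤ j → f i ≤ f j
steps⇒mono step {j = zero}  z≤n = ≤-refl
steps⇒mono step {i} {suc j} i≤1+j with m≤n⇒m<n∨m≡n i≤1+j
... | inj₁ i<1+j = ≤-trans (steps⇒mono step (s≤s⁻¹ i<1+j)) (step j)
... | inj₂ refl  = ≤-refl

record IsStaircase (n : ℕ) (c : ℕ → ℕ) : Set where
  field
    mono : ∀ {i j} → i ≤ j → c i ≤ c j
    c≤   : ∀ j → c j ≤ j
    end  : c n ≡ n

-- Counting the peak-cliques of a staircase.

module Peaks (n : ℕ) (c : ℕ → ℕ) where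

  Peak : Pred ℕ 0ℓ
  Peak t = c t < c (suc t)

  peak? : Decidable Peak
  peak? t = c t <? c (suc t)

  peaksBefore : ℕ → ℕ
  peaksBefore = count peak?

  startsUpTo? : ∀ v → Decidable (λ t → Peak t × c t ≤ v)
  startsUpTo? v t = peak? t ×-dec (c t ≤? v)

  startsUpTo : ℕ → ℕ
  startsUpTo v = count (startsUpTo? v) n

  covers? : ∀ v → Decidable (λ t → Peak t × c t ≤ v × v ≤ t)
  covers? v t = peak? t ×-dec (c t ≤? v) ×-dec (v ≤? t)

  nest : ℕ → ℕ
  nest v = count (covers? v) n

  before? : ∀ v → Decidable (λ t → Peak t × t < v)
  before? v t = peak? t ×-dec (t <? v)

  module _ (stair : IsStaircase n c) where
    open IsStaircase stair

    -- Right after the peak `s` the staircase exceeds `c s`, and it never comes down again. Hence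
    -- left ends of distinct cliques are distinct.
    peak-injective : ∀ {s t} → s < t → Peak s → ¬ c s ≡ c t
    peak-injective s<t peak-s eq = <⇒≱ peak-s (≤-trans (mono s<t) (≤-reflexive (sym eq)))

    -- The witness is the last index before `k` where `c` is at most `v`: the next value exceeds
    -- `v`, so this index is a peak.
    nextPeak : ∀ {j v} k → j ≤ k → c j ≤ v → v < c k →
               ∃[ t ] (j ≤ t × t < k × c t ≤ v × Peak t)
    nextPeak {j} zero z≤n cj≤v v<ck = contradiction cj≤v (<⇒≱ v<ck)
    nextPeak {j} {v} (suc k) j≤1+k cj≤v v<c with m≤n⇒m<n∨m≡n j≤1+k
    ... | inj₂ refl = contradiction cj≤v (<⇒≱ v<c)
    ... | inj₁ j<1+k with ≤-<-connex (c k) v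
    ...   | inj₁ ck≤v = k , s≤s⁻¹ j<1+k , ≤-refl , ck≤v , ≤-<-trans ck≤v v<c
    ...   | inj₂ v<ck = let t , j≤t , t<k , rest = nextPeak k (s≤s⁻¹ j<1+k) cj≤v v<ck
                        in t , j≤t , m≤n⇒m≤1+n t<k , rest

    -- Brings `peaksBefore` to the range below `n` over which `startsUpTo` and `nest` count, so that
    -- the three compare predicate by predicate.
    peaksBefore-truncate : ∀ {j} → j ≤ n → peaksBefore j ≡ count (before? j) n
    peaksBefore-truncate {j} j≤n = trans
      (count-≐ peak? (before? j) j (λ i i<j p → p , i<j) (λ i _ → proj₁))
      (sym (count-truncate (before? j) n j≤n λ i j≤i (_ , i<j) → <⇒≱ i<j j≤i))

    -- Each peak before `j` has its left end at or below `c j`, hence at or below `v`. The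
    -- inequality is strict because `c` climbs past `v` by the time it reaches `n`, so `nextPeak`
    -- finds a further peak at or after `j` that starts by `v`.
    galois⁺ : ∀ {j v} → j < n → v < n → c j ≤ v → peaksBefore j < startsUpTo v
    galois⁺ {j} {v} j<n v<n cj≤v
      with t , j≤t , t<n , ct≤v , peak-t ← nextPeak n (<⇒≤ j<n) cj≤v (subst (v <_) (sym end) v<n)
      rewrite peaksBefore-truncate (<⇒≤ j<n) =
      count-⊂ (before? j) (startsUpTo? v) n
        (λ i _ (peak-i , i<j) → peak-i , ≤-trans (mono (<⇒≤ i<j)) cj≤v)
        t<n (λ (_ , t<j) → <⇒≱ t<j j≤t) (peak-t , ct≤v)

    -- If `v < c j`, monotonicity places every peak that starts by `v` before `j`, so there are at
    -- most `peaksBefore j` of them.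
    galois⁻ : ∀ {j v} → j < n → peaksBefore j < startsUpTo v → c j ≤ v
    galois⁻ {j} {v} j<n r<ℓ = ≮⇒≥ λ v<cj → <⇒≱ r<ℓ (begin
      startsUpTo v          ≤⟨ count-⊆ (startsUpTo? v) (before? j) n (λ i _ (peak-i , ci≤v) →
                                 peak-i , ≰⇒> λ j≤i → <⇒≱ v<cj (≤-trans (mono j≤i) ci≤v)) ⟩
      count (before? j) n   ≡⟨ peaksBefore-truncate (<⇒≤ j<n) ⟨
      peaksBefore j         ∎)
      where open ≤-Reasoning

    -- A clique that has started by `v` either still contains `v` or ended earlier. Conversely, a
    -- clique that ended before `v` has started by `v`, since `c i ≤ i`.
    nest+peaksBefore : ∀ {v} → v ≤ n → nest v + peaksBefore v ≡ startsUpTo v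
    nest+peaksBefore {v} v≤n rewrite peaksBefore-truncate v≤n = sym
      (count-⊎ (covers? v) (before? v) (startsUpTo? v) n
        (λ i _ (_ , _ , v≤i) (_ , i<v) → <⇒≱ i<v v≤i)
        (λ i _ (peak-i , ci≤v) → split i peak-i ci≤v (≤-<-connex v i))
        λ { i _ (inj₁ (peak-i , ci≤v , _)) → peak-i , ci≤v
          ; i _ (inj₂ (peak-i , i<v)) → peak-i , ≤-trans (c≤ i) (<⇒≤ i<v) })
      where
      split : ∀ i → Peak i → c i ≤ v → v ≤ i ⊎ i < v →
              (Peak i × c i ≤ v × v ≤ i) ⊎ (Peak i × i < v)
      split i peak-i ci≤v (inj₁ v≤i) = inj₁ (peak-i , ci≤v , v≤i)
      split i peak-i ci≤v (inj₂ i<v) = inj₂ (peak-i , i<v)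

    nest-beyond : ∀ {v} → n ≤ v → nest v ≡ 0
    nest-beyond {v} n≤v = count-∅ (covers? v) n λ i i<n (_ , _ , v≤i) → <⇒≱ i<n (≤-trans n≤v v≤i)

    nest-positive : ∀ {v} → v < n → 0 < nest v
    nest-positive {v} v<n = +-cancelʳ-< (peaksBefore v) 0 (nest v)
      (subst (peaksBefore v <_) (sym (nest+peaksBefore (<⇒≤ v<n))) (galois⁺ v<n v<n (c≤ v)))

    startsUpTo-≤ : ∀ v → startsUpTo v ≤ startsUpTo (suc v)
    startsUpTo-≤ v = count-⊆ (startsUpTo? v) (startsUpTo? (suc v)) n
      λ i _ (peak-i , ci≤v) → peak-i , m≤n⇒m≤1+n ci≤v

    -- The new cliques are those with left end exactly `suc v`, and `peak-injective` allows only
    -- one.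
    startsUpTo-≤1+ : ∀ v → startsUpTo (suc v) ≤ suc (startsUpTo v)
    startsUpTo-≤1+ v = begin
      startsUpTo (suc v)              ≡⟨ count-⊎ startsAt? (startsUpTo? v) (startsUpTo? (suc v)) n
                                           (λ i _ (_ , ci≡) (_ , ci≤) → <⇒≱ (≤-reflexive (sym ci≡)) ci≤)
                                           (λ i _ (peak-i , ci≤) → split i peak-i (m≤n⇒m<n∨m≡n ci≤))
                                           (λ { i _ (inj₁ (peak-i , ci≡)) → peak-i , ≤-reflexive ci≡
                                              ; i _ (inj₂ (peak-i , ci≤)) → peak-i , m≤n⇒m≤1+n ci≤ }) ⟩
      count startsAt? n + startsUpTo v   ≤⟨ +-monoˡ-≤ _ (count-subsingleton startsAt? n
                                              λ i j i<j (peak-i , ci≡) (_ , cj≡) →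
                                                peak-injective i<j peak-i (trans ci≡ (sym cj≡))) ⟩
      suc (startsUpTo v)              ∎
      where
      open ≤-Reasoning
      startsAt? : Decidable (λ t → Peak t × c t ≡ suc v)
      startsAt? t = peak? t ×-dec (c t ≟ suc v)

      split : ∀ i → Peak i → c i < suc v ⊎ c i ≡ suc v →
              (Peak i × c i ≡ suc v) ⊎ (Peak i × c i ≤ v)
      split i peak-i (inj₁ ci<) = inj₂ (peak-i , s≤s⁻¹ ci<)
      split i peak-i (inj₂ ci≡) = inj₁ (peak-i , ci≡)

    startsUpTo-0 : 0 < n → startsUpTo 0 ≡ 1
    startsUpTo-0 0<n = ≤-antisym
      (count-subsingleton (startsUpTo? 0) n λ i j i<j (peak-i , ci≤0) (_ , cj≤0) →
        peak-injective i<j peak-i (trans (n≤0⇒n≡0 ci≤0) (sym (n≤0⇒n≡0 cj≤0))))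
      (galois⁺ 0<n 0<n (c≤ 0))

    startsUpTo-n : startsUpTo n ≡ peaksBefore n
    startsUpTo-n = trans (sym (nest+peaksBefore ≤-refl)) (cong (_+ peaksBefore n) (nest-beyond ≤-refl))

    peak-last : ∀ {m} → suc m ≡ n → Peak m
    peak-last {m} refl = subst (c m <_) (sym end) (s≤s (c≤ m))

    -- A left end is at most its right end, so none lies beyond the last vertex.
    startsUpTo-last : ∀ {m} → suc m ≡ n → startsUpTo m ≡ startsUpTo n
    startsUpTo-last {m} refl = count-≐ (startsUpTo? m) (startsUpTo? n) n
      (λ i _ (peak-i , ci≤m) → peak-i , m≤n⇒m≤1+n ci≤m)
      (λ i i<n (peak-i , _) → peak-i , ≤-trans (c≤ i) (s≤s⁻¹ i<n))

-- Beyond the vertex set start a t = t, which makes the last vertex a peak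
-- without a case distinction.
start : Vec ℕ n → ℕ → ℕ
start a t = t ∸ at 0 a t

-- Peak-edges of an area sequence as peaks of its staircase.

module Area (a : Vec ℕ n) (isArea : IsArea a) where
  open IsArea isArea

  at≤ : ∀ t → at 0 a t ≤ t
  at≤ t with <-≤-connex t n
  ... | inj₂ n≤t rewrite at-≥ {d = 0} a n≤t = z≤n
  ... | inj₁ t<n with below t<n
  ...   | fin i rewrite at-toℕ {d = 0} a i = s≤s⁻¹ (bound i)

  at-step : ∀ t → at 0 a (suc t) ≤ suc (at 0 a t)
  at-step t with <-≤-connex (suc t) n
  ... | inj₂ n≤1+t rewrite at-≥ {d = 0} a n≤1+t = z≤n
  ... | inj₁ 1+t<n with below (<-trans (n<1+n t) 1+t<n)
  ...   | fin i = let j , i⋖j = next i 1+t<n in begin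
    at 0 a (suc (toℕ i))   ≡⟨ cong (at 0 a) (suc-injective i⋖j) ⟨
    at 0 a (toℕ j)         ≡⟨ at-toℕ a j ⟩
    lookup a j             ≤⟨ step i j i⋖j ⟩
    lookup a i + 1         ≡⟨ +-comm _ 1 ⟩
    suc (lookup a i)       ≡⟨ cong suc (at-toℕ a i) ⟨
    suc (at 0 a (toℕ i))   ∎
    where open ≤-Reasoning

  staircase : IsStaircase n (start a)
  staircase = record
    { mono = steps⇒mono λ t → ∸-monoʳ-≤ (suc t) (at-step t)
    ; c≤   = λ t → m∸n≤m t (at 0 a t)
    ; end  = cong (n ∸_) (at-≥ {d = 0} a ≤-refl)
    }

  start-label : ∀ i → label i ∸ lookup a i ≡ suc (start a (toℕ i))
  start-label i rewrite sym (at-toℕ {d = 0} a i) = +-∸-assoc 1 (at≤ (toℕ i))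

  edge⁺ : ∀ {i j} → toℕ i < toℕ j → start a (toℕ j) ≤ toℕ i → Edge a i j
  edge⁺ {i} {j} i<j cj≤i = s<s i<j , subst (_≤ label i) (sym (start-label j)) (s≤s cj≤i)

  edge⁻ : ∀ {i j} → Edge a i j → toℕ i < toℕ j × start a (toℕ j) ≤ toℕ i
  edge⁻ {i} {j} (i<j , cj≤i) = s≤s⁻¹ i<j , s≤s⁻¹ (subst (_≤ label i) (start-label j) cj≤i)

  open Peaks n (start a) hiding (before?)
  open IsStaircase staircase

  left : Fin n → Fin n
  left j = fromℕ< (≤-<-trans (c≤ (toℕ j)) (toℕ<n j))

  toℕ-left : ∀ j → toℕ (left j) ≡ start a (toℕ j)
  toℕ-left j = toℕ-fromℕ< _

  peak-if : ∀ j → (∀ k → j ⋖ k → start a (toℕ j) < start a (toℕ k)) → Peak (toℕ j)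
  peak-if j lt with m≤n⇒m<n∨m≡n (toℕ<n j)
  ... | inj₂ 1+j≡n = peak-last staircase 1+j≡n
  ... | inj₁ 1+j<n = let k , j⋖k = next j 1+j<n in
    subst (λ t → start a (toℕ j) < start a t) (suc-injective j⋖k) (lt k j⋖k)

  -- The missing edge on the left forces the left end of `j` to be `i` itself. The missing edge on
  -- the right forces the staircase to rise after `j`. For an isolated vertex the same two facts
  -- come from its having no neighbours.
  peakEdge⁻ : ∀ {i j} → PeakEdge a (i , j) → Peak (toℕ j) × i ≡ left j
  peakEdge⁻ {i} (inj₁ (refl , isolated)) = peak-if i lt , toℕ-injective (trans (sym ci≡i) (sym (toℕ-left i)))
    where
    ci≡i : start a (toℕ i) ≡ toℕ i
    ci≡i = ≤-antisym (c≤ (toℕ i)) (≮⇒≥ λ ci<i → isolated (left i)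
      (inj₂ (edge⁺ (subst (_< toℕ i) (sym (toℕ-left i)) ci<i) (≤-reflexive (sym (toℕ-left i))))))

    lt : ∀ k → i ⋖ k → start a (toℕ i) < start a (toℕ k)
    lt k i⋖k = subst (_< _) (sym ci≡i) (≰⇒> λ ck≤i →
      isolated k (inj₁ (edge⁺ (≤-reflexive (sym (suc-injective i⋖k))) ck≤i)))
  peakEdge⁻ {i} {j} (inj₂ (e , right , left′)) = peak-if j lt , toℕ-injective (trans (sym cj≡i) (sym (toℕ-left j)))
    where
    i<j = proj₁ (edge⁻ e)

    cj≡i : start a (toℕ j) ≡ toℕ i
    cj≡i with m≤n⇒m<n∨m≡n (proj₂ (edge⁻ e))
    ... | inj₂ eq   = eq
    ... | inj₁ cj<i =
      let k , k⋖i = prev i (≤-<-trans z≤n cj<i)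
          1+k≡i   = sym (suc-injective k⋖i)
      in contradiction
        (edge⁺ (≤-trans (≤-reflexive 1+k≡i) (<⇒≤ i<j)) (s≤s⁻¹ (subst (_ <_) (sym 1+k≡i) cj<i)))
        (left′ k k⋖i)

    lt : ∀ k → j ⋖ k → start a (toℕ j) < start a (toℕ k)
    lt k j⋖k = subst (_< _) (sym cj≡i) (≰⇒> λ ck≤i →
      right k j⋖k (edge⁺ (≤-trans i<j (≤-trans (n≤1+n _) (≤-reflexive (sym (suc-injective j⋖k))))) ck≤i))

  -- The clique ending at `j` has an edge from `left j` to `j` when `start a (toℕ j)` is below
  -- `toℕ j`; equality is the case of an isolated vertex.
  peakEdge⁺ : ∀ j → Peak (toℕ j) → PeakEdge a (left j , j)
  peakEdge⁺ j peak-j with m≤n⇒m<n∨m≡n (c≤ (toℕ j))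
  ... | inj₁ cj<j = inj₂
    ( edge⁺ (subst (_< toℕ j) (sym (toℕ-left j)) cj<j) (≤-reflexive (sym (toℕ-left j)))
    , (λ k j⋖k e → <⇒≱ peak-j (subst₂ (λ s t → start a s ≤ t) (suc-injective j⋖k) (toℕ-left j) (proj₂ (edge⁻ e))))
    , λ k k⋖i e → <⇒≱ (≤-reflexive (trans (sym (suc-injective k⋖i)) (toℕ-left j))) (proj₂ (edge⁻ e)) )
  ... | inj₂ cj≡j rewrite toℕ-injective {i = left j} {j} (trans (toℕ-left j) cj≡j) = inj₁ (refl , λ where
    k (inj₁ e) → let j<k , ck≤j = edge⁻ e in
      <⇒≱ peak-j (≤-trans (mono j<k) (≤-trans ck≤j (≤-reflexive (sym cj≡j))))
    k (inj₂ e) → let k<j , cj≤k = edge⁻ e in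
      <⇒≱ k<j (subst (_≤ toℕ k) cj≡j cj≤k))

  peakEdges-unique : Unique (peakEdges a)
  peakEdges-unique = Unique.filter⁺ (peakEdge? a) (Unique.cartesianProduct⁺ (Unique.allFin⁺ n) (Unique.allFin⁺ n))

  ∈-peakEdges⁻ : ∀ {e} → e ∈ peakEdges a → ∃[ j ] (Peak (toℕ j) × e ≡ (left j , j))
  ∈-peakEdges⁻ {i , j} e∈ =
    let peak-j , i≡ = peakEdge⁻ (proj₂ (∈-filter⁻ (peakEdge? a) {xs = cartesianProduct (allFin n) (allFin n)} e∈))
    in j , peak-j , cong (_, j) i≡

  ∈-peakEdges⁺ : ∀ j → Peak (toℕ j) → (left j , j) ∈ peakEdges a
  ∈-peakEdges⁺ j peak-j =
    ∈-filter⁺ (peakEdge? a) (∈-cartesianProduct⁺ (∈-allFin (left j)) (∈-allFin j)) (peakEdge⁺ j peak-j)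

  length-peakEdges : length (peakEdges a) ≡ peaksBefore n
  length-peakEdges = length≡count peakEdges-unique peak? (λ j → left j , j) (cong proj₂) ∈-peakEdges⁻ ∈-peakEdges⁺

  length-nest : ∀ v → length (filter (inClique? v) (peakEdges a)) ≡ nest (toℕ v)
  length-nest v = length≡count (Unique.filter⁺ (inClique? v) peakEdges-unique) (covers? (toℕ v))
    (λ j → left j , j) (cong proj₂)
    ∈⇒covers
    (λ j (peak-j , cj≤v , v≤j) → ∈-filter⁺ (inClique? v) (∈-peakEdges⁺ j peak-j)
      (s≤s (≤-trans (≤-reflexive (toℕ-left j)) cj≤v) , s≤s v≤j))
    where
    ∈⇒covers : ∀ {e} → e ∈ filter (inClique? v) (peakEdges a) →
      ∃[ j ] ((Peak (toℕ j) × start a (toℕ j) ≤ toℕ v × toℕ v ≤ toℕ j) × e ≡ (left j , j))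
    ∈⇒covers e∈ with ∈-filter⁻ (inClique? v) {xs = peakEdges a} e∈
    ... | e∈peaks , i≤v , v≤j with ∈-peakEdges⁻ e∈peaks
    ...   | j , peak-j , refl =
      j , (peak-j , ≤-trans (≤-reflexive (sym (toℕ-left j))) (s≤s⁻¹ i≤v) , s≤s⁻¹ v≤j) , refl

-- Bicolored Motzkin sequences

gap-< : ∀ {p q} → p < q → ∣ p - q ∣ ≤ 1 → q ≡ suc p
gap-< {p} {q} p<q gap = ≤-antisym (begin
  q             ≤⟨ m≤n+∣n-m∣ q p ⟩
  p + ∣ p - q ∣ ≤⟨ +-monoʳ-≤ p gap ⟩
  p + 1         ≡⟨ +-comm p 1 ⟩
  suc p         ∎) p<q
  where open ≤-Reasoning

Colored : Vec ℕ n → Subset n → Set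
Colored w M = IsMotzkin w × (∀ i → i ∈ˢ M → Plateau w i)

gap-≤ : ∀ {p q b e} → b ≤ 1 → e ≤ 1 → q + b ≡ p + e → ∣ p - q ∣ ≤ 1
gap-≤ {p} {q} {b} {e} b≤1 e≤1 eq with ≤-total p q
... | inj₁ p≤q rewrite m≤n⇒∣m-n∣≡n∸m p≤q = m≤n+o⇒m∸n≤o q p
  (≤-trans (m≤m+n q b) (≤-trans (≤-reflexive eq) (+-monoʳ-≤ p e≤1)))
... | inj₂ q≤p rewrite m≤n⇒∣n-m∣≡n∸m q≤p = m≤n+o⇒m∸n≤o p q
  (≤-trans (m≤m+n p e) (≤-trans (≤-reflexive (sym eq)) (+-monoʳ-≤ q b≤1)))

module Path (w : Vec ℕ n) (M : Subset n) where

  -- The default 0 makes the path drop from 1 to 0 after the last index. That index therefore closes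
  -- a clique, just as the last vertex is always a peak.
  height : ℕ → ℕ
  height = at 0 w

  Marked : Pred ℕ 0ℓ
  Marked t = at false M t ≡ true

  -- At t a peak-clique ends.
  Closes : Pred ℕ 0ℓ
  Closes t = height (suc t) < height t ⊎ Marked t

  -- At t + 1 a peak-clique starts.
  Opens : Pred ℕ 0ℓ
  Opens t = height t < height (suc t) ⊎ Marked t

  closes? : Decidable Closes
  closes? t = (height (suc t) <? height t) ⊎-dec (at false M t ≟ᵇ true)

  opens? : Decidable Opens
  opens? t = (height t <? height (suc t)) ⊎-dec (at false M t ≟ᵇ true)

  closed : ℕ → ℕ
  closed = count closes?

  -- The first peak-clique always starts at 0.
  opened : ℕ → ℕ
  opened v = suc (count opens? v)

  opened-mono : ∀ {i j} → i ≤ j → opened i ≤ opened j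
  opened-mono i≤j = s≤s (count-mono opens? i≤j)

  opened-≤1+ : ∀ v → opened (suc v) ≤ suc (opened v)
  opened-≤1+ v = s≤s (+-monoˡ-≤ _ (⟦⟧≤1 (opens? v)))

  ∈⇒Marked : ∀ i → i ∈ˢ M → Marked (toℕ i)
  ∈⇒Marked i i∈M = trans (at-toℕ M i) ([]=⇒lookup i∈M)

  Marked⇒∈ : ∀ i → Marked (toℕ i) → i ∈ˢ M
  Marked⇒∈ i m = lookup⇒[]= i M (trans (sym (at-toℕ M i)) m)

  height-beyond : ∀ {t} → n ≤ t → height t ≡ 0
  height-beyond = at-≥ w

  ⋖-height : ∀ {i j : Fin n} → i ⋖ j → height (suc (toℕ i)) ≡ lookup w j
  ⋖-height {j = j} i⋖j = trans (cong height (sym (suc-injective i⋖j))) (at-toℕ w j)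

  ascent⁺ : ∀ i → height (toℕ i) < height (suc (toℕ i)) → Ascent w i
  ascent⁺ i up with <-≤-connex (suc (toℕ i)) n
  ... | inj₂ n≤1+i = contradiction up (<⇒≱ (subst (_< suc (height (toℕ i))) (sym (height-beyond n≤1+i)) z<s))
  ... | inj₁ 1+i<n = let j , i⋖j = next i 1+i<n in
    j , i⋖j , subst₂ _<_ (at-toℕ w i) (⋖-height i⋖j) up

  ascent⁻ : ∀ i → Ascent w i → height (toℕ i) < height (suc (toℕ i))
  ascent⁻ i (j , i⋖j , up) = subst₂ _<_ (sym (at-toℕ w i)) (sym (⋖-height i⋖j)) up

  module _ (colored : Colored w M) where
    open IsMotzkin (proj₁ colored)

    height-positive : ∀ {t} → t < n → 0 < height t
    height-positive t<n with below t<n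
    ... | fin i = subst (0 <_) (sym (at-toℕ w i)) (positive i)

    height-first : 0 < n → height 0 ≡ 1
    height-first 0<n with fromℕ< 0<n in eq
    ... | fzero = trans (at-toℕ w fzero) (first fzero refl)

    height-last : ∀ {t} → suc t ≡ n → height t ≡ 1
    height-last {t} 1+t≡n with below (≤-reflexive 1+t≡n)
    ... | fin i = trans (at-toℕ w i) (last i 1+t≡n)

    height-gap : ∀ t → ∣ height t - height (suc t) ∣ ≤ 1
    height-gap t with <-cmp (suc t) n
    ... | tri> _ _ n<1+t rewrite height-beyond (s≤s⁻¹ n<1+t) | height-beyond (<⇒≤ n<1+t) = z≤n
    ... | tri≈ _ 1+t≡n _ rewrite height-last 1+t≡n | height-beyond (≤-reflexive (sym 1+t≡n)) = ≤-refl
    ... | tri< 1+t<n _ _ with below (<-trans (n<1+n t) 1+t<n)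
    ...   | fin i with next i 1+t<n
    ...     | j , i⋖j rewrite at-toℕ {d = 0} w i | ⋖-height i⋖j = step i j i⋖j

    marked-plateau : ∀ t → Marked t → height t ≡ height (suc t)
    marked-plateau t m with <-≤-connex t n
    ... | inj₂ n≤t = contradiction (trans (sym (at-≥ M n≤t)) m) λ ()
    ... | inj₁ t<n with below t<n
    ...   | fin i = let j , i⋖j , wi≡wj = proj₂ colored i (Marked⇒∈ i m)
                    in trans (at-toℕ w i) (trans wi≡wj (sym (⋖-height i⋖j)))

    closes-last : ∀ {t} → suc t ≡ n → Closes t
    closes-last 1+t≡n rewrite height-last 1+t≡n | height-beyond (≤-reflexive (sym 1+t≡n)) = inj₁ ≤-refl

    -- An ascent opens one clique, a descent closes one, a marked plateau does both and an unmarked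
    -- plateau neither.
    balance : ∀ t → height (suc t) + ⟦ closes? t ⟧ ≡ height t + ⟦ opens? t ⟧
    balance t with <-cmp (height t) (height (suc t))
    ... | tri< up _ _
      rewrite ⟦⟧-yes (opens? t) (inj₁ up)
            | ⟦⟧-no (closes? t) (λ { (inj₁ down) → <-asym up down ; (inj₂ m) → <-irrefl (marked-plateau t m) up }) =
      trans (+-identityʳ _) (trans (gap-< up (height-gap t)) (+-comm 1 _))
    ... | tri≈ _ flat _ = cong₂ _+_ (sym flat) (⟦⟧-cong (closes? t) (opens? t)
      (λ { (inj₁ down) → contradiction down (<-irrefl (sym flat)) ; (inj₂ m) → inj₂ m })
      (λ { (inj₁ up) → contradiction up (<-irrefl flat) ; (inj₂ m) → inj₂ m }))
    ... | tri> _ _ down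
      rewrite ⟦⟧-yes (closes? t) (inj₁ down)
            | ⟦⟧-no (opens? t) (λ { (inj₁ up) → <-asym up down ; (inj₂ m) → <-irrefl (sym (marked-plateau t m)) down }) =
      trans (+-comm _ 1) (trans (sym (gap-< down (subst (_≤ 1) (∣-∣-comm (height t) _) (height-gap t)))) (sym (+-identityʳ _)))

    -- Telescopes `balance`, starting from height 1, which accounts for the clique opened at 0.
    height+closed : 0 < n → ∀ t → height t + closed t ≡ opened t
    height+closed 0<n zero    = trans (+-identityʳ _) (height-first 0<n)
    height+closed 0<n (suc t) = begin
      height (suc t) + (⟦ closes? t ⟧ + closed t)   ≡⟨ +-assoc (height (suc t)) ⟦ closes? t ⟧ _ ⟨
      height (suc t) + ⟦ closes? t ⟧ + closed t     ≡⟨ cong (_+ closed t) (balance t) ⟩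
      height t + ⟦ opens? t ⟧ + closed t            ≡⟨ cong (_+ closed t) (+-comm (height t) _) ⟩
      ⟦ opens? t ⟧ + height t + closed t            ≡⟨ +-assoc ⟦ opens? t ⟧ (height t) _ ⟩
      ⟦ opens? t ⟧ + (height t + closed t)          ≡⟨ cong (⟦ opens? t ⟧ +_) (height+closed 0<n t) ⟩
      ⟦ opens? t ⟧ + opened t                       ≡⟨ +-suc ⟦ opens? t ⟧ _ ⟩
      opened (suc t)                                ∎
      where open ≡-Reasoning

    closed<opened : ∀ {t} → t < n → closed t < opened t
    closed<opened {t} t<n = subst (closed t <_) (height+closed (≤-<-trans z≤n t<n) t)
      (+-monoˡ-≤ (closed t) (height-positive t<n))

    -- At `n` the height is 0, so everything opened has been closed. This lets `count-attains` reach
    -- values below `opened v` in the uniqueness argument.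
    opened≤closed-n : ∀ {v} → v < n → opened v ≤ closed n
    opened≤closed-n {v} v<n = begin
      opened v               ≤⟨ opened-mono (<⇒≤ v<n) ⟩
      opened n               ≡⟨ height+closed (≤-<-trans z≤n v<n) n ⟨
      height n + closed n    ≡⟨ cong (_+ closed n) (height-beyond ≤-refl) ⟩
      closed n               ∎
      where open ≤-Reasoning

    -- Every opening after the first is an ascent or a mark, and never both, since marks sit on
    -- plateaus.
    asc+decor : 1 + length (filter (ascent? w) (allFin n)) + ∣ M ∣ ≡ opened n
    asc+decor = cong suc (begin
      length (filter (ascent? w) (allFin n)) + ∣ M ∣   ≡⟨ cong₂ _+_
                                                            (length-filter-tabulate (ascent? w) up? id ascent⁻ ascent⁺)
                                                            (∣∣≡count M marked? ∈⇒Marked Marked⇒∈) ⟩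
      count up? n + count marked? n                    ≡⟨ count-⊎ up? marked? opens? n
                                                            (λ t _ up m → <-irrefl (marked-plateau t m) up)
                                                            (λ _ _ → id) (λ _ _ → id) ⟨
      count opens? n                                   ∎)
      where
      open ≡-Reasoning
      up? : Decidable (λ t → height t < height (suc t))
      up? t = height t <? height (suc t)

      marked? : Decidable Marked
      marked? t = at false M t ≟ᵇ true

-- The edge relation of Γₐ expressed through the numbers of peak-cliques that
-- have ended before j and started up to v.
record Linked {n} (a w : Vec ℕ n) (M : Subset n) : Set where
  open Path w M
  field
    to   : ∀ {j v} → j < n → v < n → start a j ≤ v → closed j < opened v
    from : ∀ {j v} → j < n → v < n → closed j < opened v → start a j ≤ v

-- Linked area sequences and paths determine each other.

-- The path alone decides whether `start a t ≤ v`. Taking `v` to be the left end of one sequence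
-- bounds that of the other, and the roles can be exchanged.
linked-unique-area : {a a′ w : Vec ℕ n} {M : Subset n} → IsArea a → IsArea a′ →
                     Linked a w M → Linked a′ w M → a ≡ a′
linked-unique-area {n} {a} {a′} isA isA′ link link′ = at-ext a a′ λ t t<n → begin
  at 0 a t         ≡⟨ m∸[m∸n]≡n (Area.at≤ a isA t) ⟨
  t ∸ start a t    ≡⟨ cong (t ∸_) (≤-antisym (start≤ link′ link t<n) (start≤ link link′ t<n)) ⟩
  t ∸ start a′ t   ≡⟨ m∸[m∸n]≡n (Area.at≤ a′ isA′ t) ⟩
  at 0 a′ t        ∎
  where
  open ≡-Reasoning
  start≤ : ∀ {b b′ w M} → Linked b w M → Linked b′ w M → ∀ {t} → t < n → start b′ t ≤ start b t
  start≤ {b} l l′ {t} t<n = Linked.from l′ t<n s<n (Linked.to l t<n s<n ≤-refl)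
    where s<n = ≤-<-trans (m∸n≤m t (at 0 b t)) t<n

-- `start a t` is the first `v` at which `opened v` exceeds `closed t`, and there it does so by
-- exactly one. Hence `start a (suc t)` stays at or below this vertex precisely when `closed` does
-- not grow at `t`.
linked-closes : {a w : Vec ℕ n} {M : Subset n} → Linked a w M →
                ∀ {t} → suc t < n → Path.Closes w M t ⇔ start a t < start a (suc t)
linked-closes {n} {a} {w} {M} link {t} 1+t<n = mk⇔ to from
  where
  open Path w M
  module L = Linked link
  c = start a
  t<n : t < n
  t<n = <-trans (n<1+n t) 1+t<n
  ct<n : c t < n
  ct<n = ≤-<-trans (m∸n≤m t (at 0 a t)) t<n

  opened-start : opened (c t) ≤ suc (closed t)
  opened-start with c t in eq
  ... | zero  = s≤s z≤n
  -- At `v`, just below `c t`, the link fails, so `opened v` is at most `closed t`; the step to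
  -- `c t` adds at most one.
  ... | suc v = ≤-trans (opened-≤1+ v) (s≤s (≮⇒≥ λ r<ℓ →
    <⇒≱ (≤-reflexive (sym eq)) (L.from t<n (<-trans (n<1+n v) (subst (_< n) eq ct<n)) r<ℓ)))

  to : Closes t → c t < c (suc t)
  to closes = ≰⇒> λ c≤ → <⇒≱ (subst (λ b → b + closed t < opened (c t)) (⟦⟧-yes (closes? t) closes)
    (L.to 1+t<n ct<n c≤)) opened-start

  from : c t < c (suc t) → Closes t
  from c< with closes? t
  ... | yes closes = closes
  ... | no ¬closes = contradiction
    (L.from 1+t<n ct<n
      (subst (λ b → b + closed t < opened (c t)) (sym (⟦⟧-no (closes? t) ¬closes))
        (L.to t<n ct<n ≤-refl)))
    (<⇒≱ c<)

record LinkedPath {n} (a : Vec ℕ n) : Set where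
  constructor linkedPath
  field
    {w}     : Vec ℕ n
    {M}     : Subset n
    colored : Colored w M
    linked  : Linked a w M
  open Path w M public
  open Linked linked public

module _ {a : Vec ℕ n} where
  open LinkedPath

  -- Before the last index `linked-closes` reads the closings off `a` alone; the last index closes
  -- in every colored path.
  closes-⊆ : (X Y : LinkedPath a) → ∀ t → t < n → Closes X t → Closes Y t
  closes-⊆ X Y t t<n closes with m≤n⇒m<n∨m≡n t<n
  ... | inj₁ 1+t<n = Equivalence.from (linked-closes (linked Y) 1+t<n)
                       (Equivalence.to (linked-closes (linked X) 1+t<n) closes)
  ... | inj₂ 1+t≡n = closes-last Y (colored Y) 1+t≡n

  closed-≡ : (X Y : LinkedPath a) → ∀ {t} → t ≤ n → closed X t ≡ closed Y t
  closed-≡ X Y {t} t≤n = count-≐ (closes? X) (closes? Y) t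
    (λ i i<t → closes-⊆ X Y i (<-≤-trans i<t t≤n))
    (λ i i<t → closes-⊆ Y X i (<-≤-trans i<t t≤n))

  -- Otherwise choose `j` such that the closed count of `X` at `j` equals `opened Y v`. The link of
  -- `X` gives `start a j ≤ v`, and that of `Y` then makes the closed count smaller than
  -- `opened Y v`, although both paths close equally often before `j`.
  opened-≤ : (X Y : LinkedPath a) → ∀ {v} → v < n → opened X v ≤ opened Y v
  opened-≤ X Y {v} v<n = ≮⇒≥ λ oY<oX →
    let j , j<n , cXj≡oY = count-attains (closes? X) n (<-≤-trans oY<oX (opened≤closed-n X (colored X) v<n))
        cYj<oY = to Y j<n v<n (from X j<n v<n (subst (_< opened X v) (sym cXj≡oY) oY<oX))
    in <-irrefl (trans (sym (closed-≡ X Y (<⇒≤ j<n))) cXj≡oY) cYj<oY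

  height-≡ : (X Y : LinkedPath a) → ∀ t → height X t ≡ height Y t
  height-≡ X Y t with <-≤-connex t n
  ... | inj₂ n≤t = trans (height-beyond X n≤t) (sym (height-beyond Y n≤t))
  ... | inj₁ t<n = +-cancelʳ-≡ (closed X t) _ _ (begin
    height X t + closed X t   ≡⟨ height+closed X (colored X) 0<n t ⟩
    opened X t                ≡⟨ ≤-antisym (opened-≤ X Y t<n) (opened-≤ Y X t<n) ⟩
    opened Y t                ≡⟨ height+closed Y (colored Y) 0<n t ⟨
    height Y t + closed Y t   ≡⟨ cong (height Y t +_) (closed-≡ X Y (<⇒≤ t<n)) ⟨
    height Y t + closed X t   ∎)
    where
    open ≡-Reasoning
    0<n : 0 < n
    0<n = ≤-<-trans z≤n t<n

  marked-⊆ : (X Y : LinkedPath a) → ∀ {t} → t < n → Marked X t → Marked Y t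
  marked-⊆ X Y {t} t<n m with closes-⊆ X Y t t<n (inj₂ m)
  ... | inj₂ m′   = m′
  -- A mark of `X` sits on a plateau, and the heights agree, so `Y` cannot descend here.
  ... | inj₁ down = contradiction down (<-irrefl
    (trans (sym (height-≡ X Y (suc t))) (trans (sym (marked-plateau X (colored X) t m)) (height-≡ X Y t))))

  linked-unique-path : (X Y : LinkedPath a) → w X ≡ w Y × M X ≡ M Y
  linked-unique-path X Y =
    at-ext (w X) (w Y) (λ t _ → height-≡ X Y t) ,
    at-ext (M X) (M Y) λ t t<n → true-ext (marked-⊆ X Y t<n) (marked-⊆ Y X t<n)
    where
    true-ext : ∀ {x y} → (x ≡ true → y ≡ true) → (y ≡ true → x ≡ true) → x ≡ y
    true-ext {true}          f g = sym (f refl)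
    true-ext {false} {true}  f g = g refl
    true-ext {false} {false} f g = refl

-- From bicolored paths to area sequences.

module FromPath (w : Vec ℕ n) (M : Subset n) where
  open Path w M

  -- The entry of an area sequence at `j` is the number of smaller neighbours of `j`; under the
  -- desired link these are the `v` below `j` with `closed j < opened v`.
  areaBelow : ℕ → ℕ
  areaBelow j = count (λ v → closed j <? opened v) j

  area : Vec ℕ n
  area = tabulate (areaBelow ∘ toℕ)

  area-isArea : IsArea area
  area-isArea = record
    { bound = λ i → s≤s (≤-trans (≤-reflexive (lookup∘tabulate _ i)) (count≤ _ (toℕ i)))
    ; step  = λ i j i⋖j → begin
        lookup area j              ≡⟨ lookup∘tabulate _ j ⟩
        areaBelow (toℕ j)          ≡⟨ cong areaBelow (suc-injective i⋖j) ⟩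
        areaBelow (suc (toℕ i))    ≤⟨ areaBelow-step (toℕ i) ⟩
        suc (areaBelow (toℕ i))    ≡⟨ +-comm 1 _ ⟩
        areaBelow (toℕ i) + 1      ≡⟨ cong (_+ 1) (lookup∘tabulate _ i) ⟨
        lookup area i + 1          ∎
    }
    where
    open ≤-Reasoning
    areaBelow-step : ∀ t → areaBelow (suc t) ≤ suc (areaBelow t)
    -- Passing from `closed t` to `closed (suc t)` can only lose earlier vertices, and `v = t` is
    -- the one new candidate.
    areaBelow-step t = +-mono-≤ (⟦⟧≤1 (closed (suc t) <? opened t))
      (count-⊆ _ _ t λ v _ lt → ≤-<-trans (m≤n+m _ ⟦ closes? t ⟧) lt)

  -- For fixed `j` the condition `closed j < opened v` is upward closed in `v` and holds at `j`,
  -- because heights are positive. Its least solution is `j ∸ areaBelow j`, which is `start area j`.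
  area-linked : Colored w M → Linked area w M
  area-linked colored = record
    { to   = λ {j} {v} j<n _ cj≤v → threshold⁻ (λ v → closed j <? opened v) (upward j) {j}
               (closed<opened colored j<n) (subst (_≤ v) (start-area j<n) cj≤v)
    ; from = λ {j} {v} j<n _ lt → subst (_≤ v) (sym (start-area j<n))
               (threshold⁺ (λ v → closed j <? opened v) (upward j) {j} lt)
    }
    where
    upward : ∀ j {u v} → u ≤ v → closed j < opened u → closed j < opened v
    upward j u≤v lt = <-≤-trans lt (opened-mono u≤v)

    start-area : ∀ {j} → j < n → start area j ≡ j ∸ areaBelow j
    start-area j<n with below j<n
    ... | fin i = cong (toℕ i ∸_) (at-tabulate (areaBelow ∘ toℕ) i)

-- From area sequences to bicolored paths.

nestVec : Vec ℕ n → Vec ℕ n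
nestVec a = tabulate λ v → length (filter (inClique? v) (peakEdges a))

starts? : ∀ n (c : ℕ → ℕ) → Decidable (λ t → Peaks.startsUpTo n c t < Peaks.startsUpTo n c (suc t))
starts? n c t = startsUpTo t <? startsUpTo (suc t)
  where open Peaks n c

-- One peak-clique ends at `t` and another starts at `t + 1`, so the nesting stays the same: these
-- plateaus receive the star.
markedPeak? : (a : Vec ℕ n) → Decidable _
markedPeak? {n} a t = Peaks.peak? n (start a) t ×-dec starts? n (start a) t

markSet : Vec ℕ n → Subset n
markSet a = tabulate λ i → does (markedPeak? a (toℕ i))

module ToPath (a : Vec ℕ n) (isArea : IsArea a) where
  open Area a isArea
  open Peaks n (start a)
  open Path (nestVec a) (markSet a)

  private
    Starts : Pred ℕ 0ℓ
    Starts t = startsUpTo t < startsUpTo (suc t)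

    start? : Decidable Starts
    start? = starts? n (start a)

  height≡nest : ∀ t → height t ≡ nest t
  height≡nest t with <-≤-connex t n
  ... | inj₂ n≤t = trans (height-beyond n≤t) (sym (nest-beyond staircase n≤t))
  ... | inj₁ t<n with below t<n
  ...   | fin i = trans (at-tabulate _ i) (length-nest i)

  marked⁻ : ∀ {t} → t < n → Marked t → Peak t × Starts t
  marked⁻ t<n m with below t<n
  ... | fin i = does-true⁻ (markedPeak? a (toℕ i)) (trans (sym (at-tabulate _ i)) m)

  marked⁺ : ∀ {t} → t < n → Peak t → Starts t → Marked t
  marked⁺ t<n p s with below t<n
  ... | fin i = trans (at-tabulate _ i) (dec-true (markedPeak? a (toℕ i)) (p , s))

  startsUpTo-suc : ∀ t → startsUpTo (suc t) ≡ ⟦ start? t ⟧ + startsUpTo t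
  startsUpTo-suc t with start? t
  ... | yes s = trans (≤-antisym (startsUpTo-≤1+ staircase t) s)
                      (cong (_+ startsUpTo t) (sym (⟦⟧-yes (start? t) s)))
  ... | no ¬s = trans (≤-antisym (≮⇒≥ ¬s) (startsUpTo-≤ staircase t))
                      (cong (_+ startsUpTo t) (sym (⟦⟧-no (start? t) ¬s)))

  -- The counterpart of `balance` on the staircase side, obtained by comparing `nest+peaksBefore` at
  -- `t` and at `suc t`.
  nest-balance : ∀ {t} → t < n → nest (suc t) + ⟦ peak? t ⟧ ≡ nest t + ⟦ start? t ⟧
  nest-balance {t} t<n = +-cancelʳ-≡ (peaksBefore t) _ _ (begin
    nest (suc t) + ⟦ peak? t ⟧ + peaksBefore t     ≡⟨ +-assoc (nest (suc t)) ⟦ peak? t ⟧ _ ⟩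
    nest (suc t) + peaksBefore (suc t)             ≡⟨ nest+peaksBefore staircase t<n ⟩
    startsUpTo (suc t)                             ≡⟨ startsUpTo-suc t ⟩
    ⟦ start? t ⟧ + startsUpTo t                    ≡⟨ cong (⟦ start? t ⟧ +_) (nest+peaksBefore staircase (<⇒≤ t<n)) ⟨
    ⟦ start? t ⟧ + (nest t + peaksBefore t)        ≡⟨ +-assoc ⟦ start? t ⟧ (nest t) _ ⟨
    ⟦ start? t ⟧ + nest t + peaksBefore t          ≡⟨ cong (_+ peaksBefore t) (+-comm ⟦ start? t ⟧ (nest t)) ⟩
    nest t + ⟦ start? t ⟧ + peaksBefore t          ∎)
    where open ≡-Reasoning

  module _ {t} (t<n : t < n) where

    height-balance : ∀ {b e} → ⟦ peak? t ⟧ ≡ b → ⟦ start? t ⟧ ≡ e → height (suc t) + b ≡ height t + e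
    height-balance refl refl rewrite height≡nest t | height≡nest (suc t) = nest-balance t<n

    -- If a clique also starts at `t + 1`, the mark records the closing; otherwise the height drops
    -- by one.
    closes⁺ : Peak t → Closes t
    closes⁺ p with start? t
    ... | yes s = inj₂ (marked⁺ t<n p s)
    ... | no ¬s = inj₁ (≤-reflexive (trans (+-comm 1 _)
      (trans (height-balance (⟦⟧-yes (peak? t) p) (⟦⟧-no (start? t) ¬s)) (+-identityʳ _))))

    closes⁻ : Closes t → Peak t
    closes⁻ (inj₂ m) = proj₁ (marked⁻ t<n m)
    closes⁻ (inj₁ down) with peak? t
    ... | yes p = p
    ... | no ¬p = contradiction down (≤⇒≯ (≤-trans (m≤m+n (height t) _)
      (≤-reflexive (trans (sym (height-balance (⟦⟧-no (peak? t) ¬p) refl)) (+-identityʳ _)))))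

    opens⁺ : Starts t → Opens t
    opens⁺ s with peak? t
    ... | yes p = inj₂ (marked⁺ t<n p s)
    ... | no ¬p = inj₁ (≤-reflexive (trans (+-comm 1 _)
      (trans (sym (height-balance (⟦⟧-no (peak? t) ¬p) (⟦⟧-yes (start? t) s))) (+-identityʳ _))))

    opens⁻ : Opens t → Starts t
    opens⁻ (inj₂ m) = proj₂ (marked⁻ t<n m)
    opens⁻ (inj₁ up) with start? t
    ... | yes s = s
    ... | no ¬s = contradiction up (≤⇒≯ (≤-trans (m≤m+n (height (suc t)) _)
      (≤-reflexive (trans (height-balance refl (⟦⟧-no (start? t) ¬s)) (+-identityʳ _)))))

  closed≡ : ∀ {t} → t ≤ n → closed t ≡ peaksBefore t
  closed≡ {t} t≤n = count-≐ closes? peak? t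
    (λ i i<t → closes⁻ (<-≤-trans i<t t≤n)) (λ i i<t → closes⁺ (<-≤-trans i<t t≤n))

  opened≡ : 0 < n → ∀ {v} → v ≤ n → opened v ≡ startsUpTo v
  -- The 1 built into `opened` is the clique starting at vertex 0, which exists as `0 < n`.
  opened≡ 0<n {zero}  _   = sym (startsUpTo-0 staircase 0<n)
  opened≡ 0<n {suc v} v<n = begin
    suc (⟦ opens? v ⟧ + count opens? v)   ≡⟨ +-suc ⟦ opens? v ⟧ _ ⟨
    ⟦ opens? v ⟧ + opened v               ≡⟨ cong₂ _+_ (⟦⟧-cong (opens? v) (start? v) (opens⁻ v<n) (opens⁺ v<n))
                                                       (opened≡ 0<n (<⇒≤ v<n)) ⟩
    ⟦ start? v ⟧ + startsUpTo v           ≡⟨ startsUpTo-suc v ⟨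
    startsUpTo (suc v)                    ∎
    where open ≡-Reasoning

  path-linked : Linked a (nestVec a) (markSet a)
  path-linked = record
    { to   = λ j<n v<n cj≤v → subst₂ _<_ (sym (closed≡ (<⇒≤ j<n)))
               (sym (opened≡ (≤-<-trans z≤n j<n) (<⇒≤ v<n))) (galois⁺ staircase j<n v<n cj≤v)
    ; from = λ j<n v<n lt → galois⁻ staircase j<n (subst₂ _<_ (closed≡ (<⇒≤ j<n))
               (opened≡ (≤-<-trans z≤n j<n) (<⇒≤ v<n)) lt)
    }

  nest≡lookup : ∀ i → nest (toℕ i) ≡ lookup (nestVec a) i
  nest≡lookup i = trans (sym (height≡nest (toℕ i))) (at-toℕ (nestVec a) i)

  nest≡lookup-suc : ∀ {i j : Fin n} → i ⋖ j → nest (suc (toℕ i)) ≡ lookup (nestVec a) j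
  nest≡lookup-suc {j = j} i⋖j = trans (cong nest (sym (suc-injective i⋖j))) (nest≡lookup j)

  nest-0 : 0 < n → nest 0 ≡ 1
  nest-0 0<n = trans (sym (+-identityʳ _)) (trans (nest+peaksBefore staircase z≤n) (startsUpTo-0 staircase 0<n))

  -- By the last vertex every clique has started, and all but the one ending there have ended
  -- before.
  nest-last : ∀ {m} → suc m ≡ n → nest m ≡ 1
  nest-last {m} 1+m≡n = +-cancelʳ-≡ (peaksBefore m) _ _ (begin
    nest m + peaksBefore m         ≡⟨ nest+peaksBefore staircase (<⇒≤ (≤-reflexive 1+m≡n)) ⟩
    startsUpTo m                   ≡⟨ startsUpTo-last staircase 1+m≡n ⟩
    startsUpTo n                   ≡⟨ startsUpTo-n staircase ⟩
    peaksBefore n                  ≡⟨ cong peaksBefore 1+m≡n ⟨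
    ⟦ peak? m ⟧ + peaksBefore m    ≡⟨ cong (_+ peaksBefore m) (⟦⟧-yes (peak? m) (peak-last staircase 1+m≡n)) ⟩
    1 + peaksBefore m              ∎)
    where open ≡-Reasoning

  isMotzkin : IsMotzkin (nestVec a)
  isMotzkin = record
    { positive = λ i → subst (0 <_) (nest≡lookup i) (nest-positive staircase (toℕ<n i))
    ; first    = λ i label≡1 → trans (sym (nest≡lookup i))
                   (trans (cong nest (suc-injective label≡1)) (nest-0 (≤-<-trans z≤n (toℕ<n i))))
    ; last     = λ i label≡n → trans (sym (nest≡lookup i)) (nest-last label≡n)
    ; step     = λ i j i⋖j → subst₂ (λ p q → ∣ p - q ∣ ≤ 1) (nest≡lookup i) (nest≡lookup-suc i⋖j)
                   (gap-≤ (⟦⟧≤1 (peak? (toℕ i))) (⟦⟧≤1 (start? (toℕ i))) (nest-balance (toℕ<n i)))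
    }

  marked-isPlateau : ∀ i → i ∈ˢ markSet a → Plateau (nestVec a) i
  marked-isPlateau i i∈ with marked⁻ (toℕ<n i) (∈⇒Marked i i∈) | m≤n⇒m<n∨m≡n (toℕ<n i)
  -- No clique starts beyond the last vertex, so the last index cannot be marked.
  ... | _ , s | inj₂ 1+i≡n = contradiction s
    (<-irrefl (trans (startsUpTo-last staircase 1+i≡n) (cong startsUpTo (sym 1+i≡n))))
  ... | p , s | inj₁ 1+i<n = let j , i⋖j = next i 1+i<n in j , i⋖j , (begin
    lookup (nestVec a) i   ≡⟨ nest≡lookup i ⟨
    nest (toℕ i)           ≡⟨ +-cancelʳ-≡ 1 _ _ balance-1 ⟨
    nest (suc (toℕ i))     ≡⟨ nest≡lookup-suc i⋖j ⟩
    lookup (nestVec a) j   ∎)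
    where
    open ≡-Reasoning
    balance-1 : nest (suc (toℕ i)) + 1 ≡ nest (toℕ i) + 1
    balance-1 = begin
      nest (suc (toℕ i)) + 1                     ≡⟨ cong (nest (suc (toℕ i)) +_) (⟦⟧-yes (peak? (toℕ i)) p) ⟨
      nest (suc (toℕ i)) + ⟦ peak? (toℕ i) ⟧     ≡⟨ nest-balance (toℕ<n i) ⟩
      nest (toℕ i) + ⟦ start? (toℕ i) ⟧          ≡⟨ cong (nest (toℕ i) +_) (⟦⟧-yes (start? (toℕ i)) s) ⟩
      nest (toℕ i) + 1                           ∎

  path-colored : Colored (nestVec a) (markSet a)
  path-colored = isMotzkin , marked-isPlateau

  peaks≡1+asc+decor : 0 < n → length (peakEdges a) ≡
    1 + length (filter (ascent? (nestVec a)) (allFin n)) + ∣ markSet a ∣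
  peaks≡1+asc+decor 0<n = begin
    length (peakEdges a)   ≡⟨ length-peakEdges ⟩
    peaksBefore n          ≡⟨ startsUpTo-n staircase ⟨
    startsUpTo n           ≡⟨ opened≡ 0<n ≤-refl ⟨
    opened n               ≡⟨ asc+decor path-colored ⟨
    _                      ∎
    where open ≡-Reasoning

-- The bijection.

toPath : DP n → MP* n
toPath (a , [ isArea ]) =
  ((nestVec a , [ ToPath.isMotzkin a isArea ]) , markSet a) , [ ToPath.marked-isPlateau a isArea ]

toPath-injective : {a a′ : DP n} → toPath a ≡ toPath a′ → a ≡ a′
toPath-injective {n} {a , [ isArea ]} {a′ , [ isArea′ ]} eq =
  -- The validity proofs are irrelevant, so the equality derived from them is irrelevant too;
  -- decidability of equality on vectors recovers it.
  value-injective (recompute (≡-dec _≟_ a a′) (linked-unique-area isArea isArea′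
    (ToPath.path-linked a isArea)
    (subst₂ (Linked a′) (sym (cong (value ∘ uncolored) eq)) (sym (cong marks eq)) (ToPath.path-linked a′ isArea′))))

-- The given path and the path built from its area sequence are both linked to that sequence, so
-- they coincide.
path-area : (w : Vec ℕ n) (M : Subset n) → Colored w M →
            nestVec (FromPath.area w M) ≡ w × markSet (FromPath.area w M) ≡ M
path-area w M colored = linked-unique-path
  (linkedPath (ToPath.path-colored area area-isArea) (ToPath.path-linked area area-isArea))
  (linkedPath colored (area-linked colored))
  where open FromPath w M

toPath-surjective : (w* : MP* n) → Σ[ a ∈ DP n ] toPath a ≡ w*
toPath-surjective {n} (((w , [ isMotzkin ]) , M) , [ plateaus ]) =
  (area , [ area-isArea ]) ,
  MP*-≡ (recompute (≡-dec _≟_ _ w) (proj₁ (path-area w M (isMotzkin , plateaus))))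
        (recompute (≡-dec _≟ᵇ_ _ M) (proj₂ (path-area w M (isMotzkin , plateaus))))
  where
  open FromPath w M

  MP*-≡ : {x y : MP* n} → value (uncolored x) ≡ value (uncolored y) → marks x ≡ marks y → x ≡ y
  MP*-≡ w≡ M≡ = value-injective (cong₂ _,_ (value-injective w≡) M≡)

theorem3p8 : (n : ℕ) →
    Σ[ φ ∈ (DP n ⤖ MP* n) ]
    ((a : DP n) →
    (pnv a ≡ value (uncolored (Bijection.to φ a))) ×
    (1 ≤ n → peak a ≡ 1 + asc (Bijection.to φ a) + decor (Bijection.to φ a)))
theorem3p8 n =
  mk⤖ (toPath-injective , strictlySurjective⇒surjective toPath-surjective) ,
  -- Property (i) holds by definition, as `nestVec` unfolds to `pnv`. The count in (ii) is claimed
  -- for `1 ≤ n`: on the empty sequence the left side is 0 and the right side is 1.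
  λ (a , [ isArea ]) → refl , λ 1≤n →
    recompute (_ ≟ _) (ToPath.peaks≡1+asc+decor a isArea 1≤n)
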